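{- Suppose that $\mathcal D=(\mathcal P,\mathcal B,\mathcal I)$ is a non-trivial $G$-pairwise transitive $2$-design, where $G\le\mathrm{Aut}(\mathcal D)$, and that there exists a $G$-invariant partition $\mathcal S$ of $\mathcal B$ such that $G^{\mathcal S}$ is $2$-transitive. If the actions $G^{\mathcal S}$ and $G^{\mathcal P}$ are equivalent, then the parts of $\mathcal S$ have size $1$, and $\mathcal D$ is the complete design $C_{v,v-1}$, where $v=|\mathcal P|$.
   Context: A design $\mathcal D=(\mathcal P,\mathcal B,\mathcal I)$ consists of finite sets $\mathcal P$ (points), $\mathcal B$ (blocks) and an incidence relation $\mathcal I\subseteq\mathcal P\times\mathcal B$. It is a $2$-$(v,k,\lambda)$ design (or $2$-design) if $|\mathcal P|=v$, each block is incident with exactly $k$ points, and each pair of distinct points is incident with exactly $\lambda$ common blocks. It is non-trivial if $2<k<v$. The complete design $C_{v,k}$ has $v$ points and, for each $k$-subset $S$ of points, exactly one block whose set of incident points is $S$. An automorphism is a permutation of $\mathcal P\cup\mathcal B$ leaving $\mathcal P$ and $\mathcal B$ invariant setwise and preserving incidence; $\mathrm{Aut}(\mathcal D)$ is the group of all automorphisms. Two blocks are intersecting if some point is incident with both. For $G\le\mathrm{Aut}(\mathcal D)$, the $2$-design $\mathcal D$ is $G$-pairwise transitive if $G$ is transitive on each of the following five (possibly empty) sets of ordered pairs: pairs of distinct points, incident point-block pairs, non-incident point-block pairs, pairs of distinct intersecting blocks, pairs of non-intersecting blocks. $G^{X}$ denotes the permutation group induced by $G$ on $X$; the actions on $\mathcal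 S$ and $\mathcal P$ are equivalent if there is a $G$-equivariant bijection $\mathcal P\to\mathcal S$. -}

module Defs where

open import Algebra.Bundles using (Group)
open import Data.Bool.Base using (Bool; T)
open import Data.Fin.Base using (Fin)
open import Data.Fin.Permutation as Perm
  using (Permutation′; _⟨$⟩ʳ_; _⟨$⟩ˡ_; _∘ₚ_; flip)
open import Data.Fin.Subset using (Subset; Nonempty; ∣_∣; _∩_; _∈_)
open import Data.Nat.Base using (ℕ; _<_)
open import Data.Product using (∃; ∃!; _×_; _,_)
open import Data.Vec.Base using (tabulate; lookup)
open import Function.Base using (_∘_)
open import Level using (Level; 0ℓ; _⊔_)
open import Relation.Binary.Core using (REL)
open import Relation.Binary.PropositionalEquality
  using (_≡_; _≢_; refl; sym; trans; cong; cong₂)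
open import Relation.Nullary.Negation using (¬_)
open import Relation.Unary using (Pred)

private
  variable
    a c ℓ ℓ′ p s : Level
    v b : ℕ

------------------------------------------------------------------------
-- Designs

-- The point set is Fin v and the block set is Fin b.  Distinct blocks
-- may be incident with the same set of points.
record Design (v b : ℕ) : Set where
  field
    incident : Fin v → Fin b → Bool

  infix 4 _I_
  _I_ : REL (Fin v) (Fin b) 0ℓ
  x I β = T (incident x β)

  pointsOn : Fin b → Subset v
  pointsOn β = tabulate (λ x → incident x β)

  blocksOn : Fin v → Subset b
  blocksOn x = tabulate (incident x)

  Intersecting : REL (Fin b) (Fin b) 0ℓ
  Intersecting β γ = ∃ λ x → x I β × x I γ

record Is2Design (D : Design v b) (k lam : ℕ) : Set where
  open Design D
  field
    blockSize : ∀ β → ∣ pointsOn β ∣ ≡ k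
    balanced  : ∀ {x y} → x ≢ y → ∣ blocksOn x ∩ blocksOn y ∣ ≡ lam

NonTrivial : (v k : ℕ) → Set
NonTrivial v k = 2 < k × k < v

-- D is C_{v,k}, up to the labelling of its blocks.
record IsCompleteDesign (D : Design v b) (k : ℕ) : Set where
  open Design D
  field
    blockSize : ∀ β → ∣ pointsOn β ∣ ≡ k
    uniqueBlock : ∀ X → ∣ X ∣ ≡ k → ∃! _≡_ (λ β → pointsOn β ≡ X)

------------------------------------------------------------------------
-- Automorphisms

-- A permutation of the disjoint union of the points and the blocks which
-- leaves both parts invariant is a pair of permutations, one of each part.
record Automorphism (D : Design v b) : Set where
  open Design D
  field
    onPoints : Permutation′ v
    onBlocks : Permutation′ b
    preserves : ∀ x β →
      incident (onPoints ⟨$⟩ʳ x) (onBlocks ⟨$⟩ʳ β) ≡ incident x β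

  point : Fin v → Fin v
  point = onPoints ⟨$⟩ʳ_

  block : Fin b → Fin b
  block = onBlocks ⟨$⟩ʳ_

  -- The setwise image { block β ∣ β ∈ X }.
  blocks : Subset b → Subset b
  blocks X = tabulate (λ β → lookup X (onBlocks ⟨$⟩ˡ β))

open Automorphism public using (point; block; blocks)

-- Automorphisms are compared pointwise, and g ∙ h is "first g, then h".
Aut : Design v b → Group 0ℓ 0ℓ
Aut D = record
  { Carrier = Automorphism D
  ; _≈_ = λ g h → onPoints g Perm.≈ onPoints h × onBlocks g Perm.≈ onBlocks h
  ; _∙_ = λ g h → record
      { onPoints = onPoints g ∘ₚ onPoints h
      ; onBlocks = onBlocks g ∘ₚ onBlocks h
      ; preserves = λ x β →
          trans (preserves h (point g x) (block g β)) (preserves g x β)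
      }
  ; ε = record
      { onPoints = Perm.id
      ; onBlocks = Perm.id
      ; preserves = λ _ _ → refl
      }
  ; _⁻¹ = λ g → record
      { onPoints = flip (onPoints g)
      ; onBlocks = flip (onBlocks g)
      ; preserves = λ x β →
          trans (sym (preserves g (onPoints g ⟨$⟩ˡ x) (onBlocks g ⟨$⟩ˡ β)))
                (cong₂ incident (Perm.inverseʳ (onPoints g))
                                (Perm.inverseʳ (onBlocks g)))
      }
  ; isGroup = record
      { isMonoid = record
          { isSemigroup = record
              { isMagma = record
                  { isEquivalence = record
                      { refl = (λ _ → refl) , (λ _ → refl)
                      ; sym = λ (e , f) → sym ∘ e , sym ∘ f
                      ; trans = λ (e , f) (e′ , f′) →
                          (λ x → trans (e x) (e′ x)) ,
                          (λ β → trans (f β) (f′ β))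
                      }
                  ; ∙-cong = λ {_} {g′} {h} (e , f) (e′ , f′) →
                      (λ x → trans (cong (point h) (e x)) (e′ (point g′ x))) ,
                      (λ β → trans (cong (block h) (f β)) (f′ (block g′ β)))
                  }
              ; assoc = λ _ _ _ → (λ _ → refl) , (λ _ → refl)
              }
          ; identity = (λ _ → (λ _ → refl) , (λ _ → refl))
                     , (λ _ → (λ _ → refl) , (λ _ → refl))
          }
      ; inverse = (λ g → (λ _ → Perm.inverseʳ (onPoints g))
                       , (λ _ → Perm.inverseʳ (onBlocks g)))
                , (λ g → (λ _ → Perm.inverseˡ (onPoints g))
                       , (λ _ → Perm.inverseˡ (onBlocks g)))
      ; ⁻¹-cong = λ {g} {h} (e , f) →
          flip-cong (onPoints g) (onPoints h) e ,
          flip-cong (onBlocks g) (onBlocks h) f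
      }
  }
  where
  open Design D
  open Automorphism using (onPoints; onBlocks; preserves)

  flip-cong : ∀ {n} (π ρ : Permutation′ n) →
              π Perm.≈ ρ → flip π Perm.≈ flip ρ
  flip-cong π ρ π≈ρ i =
    trans (sym (Perm.inverseˡ ρ))
          (cong (ρ ⟨$⟩ˡ_) (trans (sym (π≈ρ (π ⟨$⟩ˡ i))) (Perm.inverseʳ π)))

record IsSubgroup (𝒢 : Group c ℓ) (H : Pred (Group.Carrier 𝒢) p) :
                  Set (c ⊔ ℓ ⊔ p) where
  open Group 𝒢
  field
    resp : ∀ {g h} → g ≈ h → H g → H h
    ε-closed : H ε
    ∙-closed : ∀ {g h} → H g → H h → H (g ∙ h)
    ⁻¹-closed : ∀ {g} → H g → H (g ⁻¹)

------------------------------------------------------------------------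
-- Transitivity

module _ {D : Design v b} (G : Pred (Automorphism D) ℓ) where

  open Design D

  -- G, acting on A by act and on C by act′, is transitive on the set R of
  -- ordered pairs.
  TransitiveOn : {A : Set a} {C : Set c} →
                 (Automorphism D → A → A) → (Automorphism D → C → C) →
                 REL A C ℓ′ → Set (ℓ ⊔ a ⊔ c ⊔ ℓ′)
  TransitiveOn act act′ R = ∀ {x y x′ y′} → R x y → R x′ y′ →
    ∃ λ g → G g × act g x ≡ x′ × act′ g y ≡ y′

  record PairwiseTransitive : Set ℓ where
    field
      onPointPairs : TransitiveOn point point _≢_
      onFlags : TransitiveOn point block _I_
      onAntiflags : TransitiveOn point block (λ x β → ¬ x I β)
      onIntersecting :
        TransitiveOn block block (λ β γ → β ≢ γ × Intersecting β γ)
      onNonIntersecting :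
        TransitiveOn block block (λ β γ → ¬ Intersecting β γ)

------------------------------------------------------------------------
-- Partitions of the block set, given as sets of subsets of Fin b

record IsPartition (𝒮 : Pred (Subset b) s) : Set s where
  field
    nonempty : ∀ {X} → 𝒮 X → Nonempty X
    uniquePart : ∀ β → ∃! _≡_ (λ X → 𝒮 X × β ∈ X)

module _ {D : Design v b} (G : Pred (Automorphism D) ℓ)
         (𝒮 : Pred (Subset b) s) where

  Invariant : Set (ℓ ⊔ s)
  Invariant = ∀ {g X} → G g → 𝒮 X → 𝒮 (blocks g X)

  TwoTransitiveOnParts : Set (ℓ ⊔ s)
  TwoTransitiveOnParts =
    TransitiveOn G blocks blocks (λ X Y → 𝒮 X × 𝒮 Y × X ≢ Y)

  -- A G-equivariant bijection from the points to 𝒮.  Bijectivity concerns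
  -- the subsets themselves, not the proofs that they belong to 𝒮.
  record EquivalentToPoints : Set (ℓ ⊔ s) where
    field
      part : Fin v → Subset b
      part∈𝒮 : ∀ x → 𝒮 (part x)
      injective : ∀ {x y} → part x ≡ part y → x ≡ y
      surjective : ∀ {X} → 𝒮 X → ∃ λ x → part x ≡ X
      equivariant : ∀ {g} → G g → ∀ x → part (point g x) ≡ blocks g (part x)

{-# OPTIONS --safe #-}
-- An equivalence between G on 𝒮 and G on the points amounts to a
-- G-equivariant surjection base from blocks to points, whose fibres are the
-- parts.  The stabiliser of a block β fixes base β, and it is transitive on
-- the points on β and on the points off β.  Since β has more than one point,
-- base β lies off β, so it is the only point off β and k = v - 1.  Now any two
-- blocks intersect, so G is transitive on pairs of distinct blocks; as base is
-- equivariant and not constant, it must be injective.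
module Submission where

open import Defs
open import Data.Bool.Properties using (T-≡)
open import Data.Fin.Base using (Fin)
import Data.Fin.Permutation as Perm
open import Data.Fin.Properties using (_≟_; any?)
open import Data.Fin.Subset using (Subset; ∣_∣; _∈_; _∉_; _⊆_; ⁅_⁆; ∁; ⊤)
open import Data.Fin.Subset.Properties
open import Data.Nat.Base using (ℕ; _∸_; _<_; z<s; s<s)
open import Data.Nat.Properties
  using (≤⇒≯; <-irrefl; <-trans; ∸-monoʳ-<)
open import Data.Product.Base using (_×_; _,_; ∃; proj₁; proj₂)
open import Data.Vec.Base using (lookup)
open import Data.Vec.Properties using (lookup∘tabulate; []=⇒lookup; lookup⇒[]=)
open import Function.Bundles using (Equivalence)
open import Level using (Level)
open import Relation.Binary.PropositionalEquality
  using (_≡_; _≢_; refl; sym; trans; cong; subst; subst₂)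
open import Relation.Nullary.Decidable
  using (yes; no; _×-dec_; ¬?; decidable-stable; T?)
open import Relation.Nullary.Negation using (¬_; contradiction)
open import Relation.Unary using (Pred)

private
  variable
    ℓ s : Level
    n v b : ℕ
    p q : Subset n

∣p∣<∣q∣⇒∃∈q∉p : ∣ p ∣ < ∣ q ∣ → ∃ λ x → x ∈ q × x ∉ p
∣p∣<∣q∣⇒∃∈q∉p {p = p} {q = q} ∣p∣<∣q∣
  with any? (λ x → (x ∈? q) ×-dec ¬? (x ∈? p))
... | yes found = found
... | no ¬found = contradiction ∣p∣<∣q∣
  (≤⇒≯ (p⊆q⇒∣p∣≤∣q∣ λ {x} x∈q →
    decidable-stable (x ∈? p) λ x∉p → ¬found (x , x∈q , x∉p)))

1<∣p∣⇒∃≢ : 1 < ∣ p ∣ → ∀ x → ∃ λ y → y ∈ p × y ≢ x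
1<∣p∣⇒∃≢ {p = p} 1<∣p∣ x =
  let y , y∈p , y∉⁅x⁆ = ∣p∣<∣q∣⇒∃∈q∉p (subst (_< ∣ p ∣) (sym (∣⁅x⁆∣≡1 x)) 1<∣p∣)
  in y , y∈p , x∉⁅y⁆⇒x≢y y∉⁅x⁆

p⊆q∧∣p∣≡∣q∣⇒p≡q : p ⊆ q → ∣ p ∣ ≡ ∣ q ∣ → p ≡ q
p⊆q∧∣p∣≡∣q∣⇒p≡q {p = p} p⊆q ∣p∣≡∣q∣ = ⊆-antisym p⊆q λ {x} x∈q →
  decidable-stable (x ∈? p) λ x∉p →
    <-irrefl ∣p∣≡∣q∣ (p⊂q⇒∣p∣<∣q∣ (p⊆q , x , x∈q , x∉p))

∣∁⁅x⁆∣≡n∸1 : (x : Fin n) → ∣ ∁ ⁅ x ⁆ ∣ ≡ n ∸ 1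
∣∁⁅x⁆∣≡n∸1 {n} x = trans (∣∁p∣≡n∸∣p∣ ⁅ x ⁆) (cong (n ∸_) (∣⁅x⁆∣≡1 x))

x∉p⇒p⊆∁⁅x⁆ : ∀ {x} → x ∉ p → p ⊆ ∁ ⁅ x ⁆
x∉p⇒p⊆∁⁅x⁆ {p = p} {x} x∉p y∈p =
  x∉p⇒x∈∁p λ y∈⁅x⁆ → x∉p (subst (_∈ p) (x∈⁅y⁆⇒x≡y x y∈⁅x⁆) y∈p)

∣p∣≡n∸1⇒p≡∁⁅x⁆ : 0 < n → {p : Subset n} → ∣ p ∣ ≡ n ∸ 1 → ∃ λ x → p ≡ ∁ ⁅ x ⁆
∣p∣≡n∸1⇒p≡∁⁅x⁆ {n} 0<n {p} ∣p∣≡n∸1 =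
  let x , _ , x∉p = ∣p∣<∣q∣⇒∃∈q∉p {p = p} {q = ⊤}
        (subst₂ _<_ (sym ∣p∣≡n∸1) (sym (∣⊤∣≡n n)) (∸-monoʳ-< z<s 0<n))
  in x , p⊆q∧∣p∣≡∣q∣⇒p≡q (x∉p⇒p⊆∁⁅x⁆ x∉p)
                          (trans ∣p∣≡n∸1 (sym (∣∁⁅x⁆∣≡n∸1 x)))

∁⁅⁆-injective : ∀ {x y : Fin n} → ∁ ⁅ x ⁆ ≡ ∁ ⁅ y ⁆ → x ≡ y
∁⁅⁆-injective {x = x} {y} eq =
  x∈⁅y⁆⇒x≡y y (x∉∁p⇒x∈p (subst (x ∉_) eq (x∈p⇒x∉∁p (x∈⁅x⁆ x))))

module _ (D : Design v b) where
  open Design D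

  ∈pointsOn⇒I : ∀ {x β} → x ∈ pointsOn β → x I β
  ∈pointsOn⇒I {x} x∈ = Equivalence.from T-≡
    (trans (sym (lookup∘tabulate _ x)) ([]=⇒lookup x∈))

  I⇒∈pointsOn : ∀ {x β} → x I β → x ∈ pointsOn β
  I⇒∈pointsOn {x} xIβ = lookup⇒[]= x _
    (trans (lookup∘tabulate _ x) (Equivalence.to T-≡ xIβ))

∈-blocks : {D : Design v b} (g : Automorphism D) {β : Fin b} {X : Subset b} →
           β ∈ X → block g β ∈ blocks g X
∈-blocks g {β} {X} β∈X = lookup⇒[]= (block g β) _
  (trans (lookup∘tabulate _ (block g β))
  (trans (cong (lookup X) (Perm.inverseˡ (Automorphism.onBlocks g)))
         ([]=⇒lookup β∈X)))

module EquivariantMap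
  (D : Design v b) (1<∣_∣ : ∀ β → 1 < ∣ Design.pointsOn D β ∣)
  (G : Pred (Automorphism D) ℓ) (transitive : PairwiseTransitive G)
  (base : Fin b → Fin v)
  (base-block : ∀ {g} → G g → ∀ β → base (block g β) ≡ point g (base β))
  where

  open Design D
  open PairwiseTransitive transitive

  base-fixed : ∀ {g β} → G g → block g β ≡ β → point g (base β) ≡ base β
  base-fixed Gg gβ≡β = trans (sym (base-block Gg _)) (cong base gβ≡β)

  base-off : ∀ β → ¬ base β I β
  base-off β base-on =
    let z , z∈β , z≢base = 1<∣p∣⇒∃≢ {p = pointsOn β} 1<∣ β ∣ (base β)
        g , Gg , g-base≡z , gβ≡β = onFlags base-on (∈pointsOn⇒I D z∈β)
    in z≢base (trans (sym g-base≡z) (base-fixed Gg gβ≡β))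

  off⇒base : ∀ {x β} → ¬ x I β → x ≡ base β
  off⇒base {β = β} x-off =
    let g , Gg , g-base≡x , gβ≡β = onAntiflags (base-off β) x-off
    in trans (sym g-base≡x) (base-fixed Gg gβ≡β)

  ≢base⇒on : ∀ {x β} → x ≢ base β → x I β
  ≢base⇒on x≢base = decidable-stable (T? _) λ x-off → x≢base (off⇒base x-off)

  pointsOn≡∁⁅base⁆ : ∀ β → pointsOn β ≡ ∁ ⁅ base β ⁆
  pointsOn≡∁⁅base⁆ β = ⊆-antisym
    (x∉p⇒p⊆∁⁅x⁆ λ base∈β → base-off β (∈pointsOn⇒I D base∈β))
    (λ x∈∁ → I⇒∈pointsOn D
      (≢base⇒on (x∉⁅y⁆⇒x≢y (x∈∁p⇒x∉p x∈∁))))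

  intersecting : ∀ β γ → Intersecting β γ
  intersecting β γ =
    let z , z∈β , z≢base = 1<∣p∣⇒∃≢ {p = pointsOn β} 1<∣ β ∣ (base γ)
    in z , ∈pointsOn⇒I D z∈β , ≢base⇒on z≢base

  module _ (base⁻¹ : ∀ x → ∃ λ β → base β ≡ x) where

    base-injective : ∀ {β γ} → base β ≡ base γ → β ≡ γ
    base-injective {β} {γ} same = decidable-stable (β ≟ γ) λ β≢γ →
      let z , _ , z≢base = 1<∣p∣⇒∃≢ {p = pointsOn β} 1<∣ β ∣ (base β)
          γ′ , base-γ′≡z = base⁻¹ z
          β≢γ′ = λ β≡γ′ → z≢base (trans (sym base-γ′≡z) (cong base (sym β≡γ′)))
          g , Gg , gβ≡β , gγ≡γ′ =
            onIntersecting (β≢γ , intersecting β γ) (β≢γ′ , intersecting β γ′)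
      in z≢base
        (trans (sym base-γ′≡z)
        (trans (cong base (sym gγ≡γ′))
        (trans (base-block Gg γ)
        (trans (cong (point g) (sym same))
               (base-fixed Gg gβ≡β)))))

    complete : 0 < v → IsCompleteDesign D (v ∸ 1)
    complete 0<v = record
      { blockSize = λ β → trans (cong ∣_∣ (pointsOn≡∁⁅base⁆ β)) (∣∁⁅x⁆∣≡n∸1 (base β))
      ; uniqueBlock = λ X ∣X∣≡v∸1 →
          let x , X≡∁⁅x⁆ = ∣p∣≡n∸1⇒p≡∁⁅x⁆ 0<v ∣X∣≡v∸1
              β , base-β≡x = base⁻¹ x
          in β
           , trans (pointsOn≡∁⁅base⁆ β)
                   (trans (cong (λ y → ∁ ⁅ y ⁆) base-β≡x) (sym X≡∁⁅x⁆))
           , λ {γ} pointsOn-γ≡X → base-injective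
               (trans base-β≡x (∁⁅⁆-injective
                 (trans (sym X≡∁⁅x⁆)
                 (trans (sym pointsOn-γ≡X) (pointsOn≡∁⁅base⁆ γ)))))
      }

module BasePoint
  {D : Design v b} {G : Pred (Automorphism D) ℓ} {𝒮 : Pred (Subset b) s}
  (partition : IsPartition 𝒮) (equivalent : EquivalentToPoints G 𝒮) where

  open IsPartition partition
  open EquivalentToPoints equivalent

  private
    part-containing : ∀ β → ∃ λ x → β ∈ part x
    part-containing β =
      let X , (𝒮X , β∈X) , _ = uniquePart β
          x , part-x≡X = surjective 𝒮X
      in x , subst (β ∈_) (sym part-x≡X) β∈X

  base : Fin b → Fin v
  base β = proj₁ (part-containing β)

  ∈part-base : ∀ β → β ∈ part (base β)
  ∈part-base β = proj₂ (part-containing β)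

  base-unique : ∀ {β x} → β ∈ part x → base β ≡ x
  base-unique {β} {x} β∈part =
    let _ , _ , unique = uniquePart β
    in injective (trans (sym (unique (part∈𝒮 (base β) , ∈part-base β)))
                        (unique (part∈𝒮 x , β∈part)))

  base-block : ∀ {g} → G g → ∀ β → base (block g β) ≡ point g (base β)
  base-block {g} Gg β = base-unique
    (subst (block g β ∈_) (sym (equivariant Gg (base β)))
           (∈-blocks g (∈part-base β)))

  base⁻¹ : ∀ x → ∃ λ β → base β ≡ x
  base⁻¹ x = let β , β∈part = nonempty (part∈𝒮 x) in β , base-unique β∈part

  parts-singleton : (∀ {β γ} → base β ≡ base γ → β ≡ γ) →
                    ∀ {X} → 𝒮 X → ∣ X ∣ ≡ 1
  parts-singleton base-injective {X} 𝒮X with surjective 𝒮X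
  ... | x , refl =
    let β , β∈part = nonempty 𝒮X
        part⊆⁅β⁆ : part x ⊆ ⁅ β ⁆
        part⊆⁅β⁆ γ∈part = subst (_∈ ⁅ β ⁆)
          (base-injective (trans (base-unique β∈part) (sym (base-unique γ∈part))))
          (x∈⁅x⁆ β)
        ⁅β⁆⊆part : ⁅ β ⁆ ⊆ part x
        ⁅β⁆⊆part γ∈⁅β⁆ = subst (_∈ part x) (sym (x∈⁅y⁆⇒x≡y β γ∈⁅β⁆)) β∈part
    in trans (cong ∣_∣ (⊆-antisym part⊆⁅β⁆ ⁅β⁆⊆part)) (∣⁅x⁆∣≡1 β)

lemma2p7 : ∀ {ℓ s : Level} {v b k lam : ℕ}
    (D : Design v b) → Is2Design D k lam → NonTrivial v k →
    (G : Pred (Automorphism D) ℓ) → IsSubgroup (Aut D) G →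
    PairwiseTransitive G →
    (𝒮 : Pred (Subset b) s) → IsPartition 𝒮 → Invariant G 𝒮 →
    TwoTransitiveOnParts G 𝒮 →
    EquivalentToPoints G 𝒮 →
    (∀ {X} → 𝒮 X → ∣ X ∣ ≡ 1) × IsCompleteDesign D (v ∸ 1)
lemma2p7 D design (2<k , k<v) G _ transitive 𝒮 partition _ _ equivalent =
  parts-singleton (base-injective base⁻¹) , complete base⁻¹ 0<v
  where
  open BasePoint partition equivalent

  0<v = <-trans z<s (<-trans 2<k k<v)

  1<∣_∣ : ∀ β → 1 < ∣ Design.pointsOn D β ∣
  1<∣ β ∣ = subst (1 <_) (sym (Is2Design.blockSize design β))
                  (<-trans (s<s z<s) 2<k)

  open EquivariantMap D 1<∣_∣ G transitive base base-block
    using (base-injective; complete)
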